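{- Fix an integer $n\ge 3$. (1) For every integer $m\ge 2$: let Wilson's algorithm be run on $G_{n,m}$, with the root on one of the boundary rings $R_0,R_{m-1}$ and the first random walk started from a vertex of the other boundary ring. Then the first loop-erased path produced by the algorithm is a trunk, i.e. it is a simple path intersecting every ring $R_0,\dots,R_{m-1}$. (2) There exist constants $C=C(n)<\infty$ and $\theta=\theta(n)\in(0,1)$ such that the following holds for every integer $m\ge 2$, where $G$ is either $G_{n,m}$ or $G_{n,m}^{\mathrm s}$. Run Wilson's algorithm on $G$; in the wired case $G=G_{n,m}^{\mathrm s}$ assume it is rooted at the sink $s$. Suppose that the current Wilson tree $F$ at some stage intersects every ring $R_0,\dots,R_{m-1}$ (so in the wired case also $s\in F$). Let $\beta$ be the next nontrivial loop-erased increment, i.e. the loop-erased path added by the algorithm for the next starting vertex not in $F$. Then $$\mathbb P\bigl(|\beta|\ge \ell \mid F\bigr)\le C\,\theta^{\ell}\qquad\text{for all integers }\ell\ge 0,$$ where the constants $C,\theta$ are independent of $m$, of $F$, and of the starting vertex.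
   Context: For $n\ge 3$, $m\ge 2$, the cylindrical graph $G_{n,m}=C_n\times P_m$ has vertex set $\{(i,j): i\in\mathbb{Z}_n,\ j\in\{0,\dots,m-1\}\}$ and edges $\{(i,j),(i+1,j)\}$ ($i\in\mathbb{Z}_n$, $0\le j\le m-1$) and $\{(i,j),(i,j+1)\}$ ($i\in\mathbb{Z}_n$, $0\le j\le m-2$). Its rings are $R_k=\{(i,k): i\in\mathbb{Z}_n\}$, $k=0,\dots,m-1$; the boundary rings are $R_0$ and $R_{m-1}$. The wired cylindrical graph $G_{n,m}^{\mathrm s}$ is obtained from $G_{n,m}$ by adding one new vertex $s$ (the sink) and the edges $\{s,v\}$ for all $v\in R_0\cup R_{m-1}$. Loop-erasure: for a finite path $\gamma$, its (chronological) loop-erasure is obtained by iteratively erasing cycles in chronological order: whenever the path first revisits a vertex, delete the loop formed between the two occurrences. The length $|\beta|$ of a path $\beta$ is its number of edges. Wilson's algorithm on a finite connected graph $G=(V,E)$: choose a root $r\in V$ and an ordering of $V\setminus\{r\}$. Starting with the tree $\{r\}$, repeatedly take the first vertex in the ordering not yet in the current tree, run (independently of the past) simple random walk from it (each step moves to a uniformly chosen neighbour) until it first hits the current tree, and add the loop-erasure of this walk (the loop-erased increment) to the tree. A trunk of a spanning tree $T$ is a simple path $L\subset T$ with $L\cap R_k\ne\varnothing$ for every $k=0,\dots,m-1$. -}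

module Defs where

import Algebra.Definitions.RawSemiring
open import Data.Empty using (⊥)
open import Data.Fin.Base using (Fin; toℕ)
import Data.Fin.Properties as Fin
open import Data.Integer.Base using (+_)
open import Data.List.Base
  using (List; []; _∷_; _++_; map; concat; concatMap; filter; find; foldl; foldr;
         reverse; dropWhile; length; allFin; cartesianProduct; [_])
import Data.List.Membership.DecPropositional as DecMembership
open import Data.List.Membership.Propositional using (_∈_)
open import Data.List.Membership.Propositional.Properties
  using (∈-cartesianProduct⁺; ∈-allFin; ∈-map⁺; ∈-map⁻)
open import Data.List.Relation.Binary.Permutation.Propositional using (_↭_)
import Data.List.Relation.Binary.Subset.DecPropositional as DecSubset
open import Data.List.Relation.Binary.Subset.Propositional using (_⊆_)
open import Data.List.Relation.Unary.All.Properties using (¬Any⇒All¬)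
open import Data.List.Relation.Unary.AllPairs using ([]; _∷_)
open import Data.List.Relation.Unary.Any using (here; there)
open import Data.List.Relation.Unary.Linked using (Linked)
open import Data.List.Relation.Unary.Unique.Propositional using (Unique)
import Data.List.Relation.Unary.Unique.Propositional.Properties as Unique
open import Data.Maybe.Base using (Maybe; just; nothing)
import Data.Maybe.Properties as Maybe
import Data.Maybe.Relation.Unary.Any as Maybe
open import Data.Nat.Base as ℕ using (ℕ; zero; suc; pred)
import Data.Nat.Properties as ℕ
open import Data.Product.Base using (∃-syntax; _×_; _,_; proj₁; proj₂; swap)
import Data.Product.Properties as Product
open import Data.Rational.Base using (ℚ; 0ℚ; 1ℚ; _/_; _+_; _*_; _≤_; _<_; +-*-rawSemiring)
open import Data.Sum.Base using (_⊎_) renaming (swap to ⊎-swap)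
open import Function.Base using (_∘_; id)
open import Relation.Binary.Core using (Rel)
import Relation.Binary.Definitions as Binary
open import Relation.Binary.PropositionalEquality using (_≡_; refl)
open import Relation.Nullary.Decidable using (yes; no; ¬?; _×-dec_; _⊎-dec_)
open import Relation.Unary using (Pred; Decidable)
open import Level using (0ℓ)

infixr 8 _^_
_^_ : ℚ → ℕ → ℚ
_^_ = Algebra.Definitions.RawSemiring._^_ +-*-rawSemiring

------------------------------------------------------------------------
-- Finitely supported sub-probability laws, as lists of weighted outcomes.
-- An outcome may be listed several times; its weights then add up.

Dist : Set → Set
Dist A = List (ℚ × A)

module _ {A : Set} where

  return : A → Dist A
  return x = [ 1ℚ , x ]

  uniform : List A → Dist A
  uniform []         = []
  uniform l@(_ ∷ xs) = map (+ 1 / suc (length xs) ,_) l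

  support : Dist A → List A
  support = map proj₂

  Pr : {P : Pred A 0ℓ} → Decidable P → Dist A → ℚ
  Pr P? d = foldr _+_ 0ℚ (map proj₁ (filter (P? ∘ proj₂) d))

module _ {A B : Set} where

  infixl 1 _>>=_
  _>>=_ : Dist A → (A → Dist B) → Dist B
  d >>= f = concatMap (λ (p , x) → map (λ (q , y) → p * q , y) (f x)) d

  infixl 4 _<$>_
  _<$>_ : (A → B) → Dist A → Dist B
  f <$> d = map (λ (p , x) → p , f x) d

-- The order of the real numbers sup a and sup b, for nondecreasing
-- bounded sequences a and b of rationals.
_≤sup_ : Rel (ℕ → ℚ) 0ℓ
a ≤sup b = ∀ N ε → 0ℚ < ε → ∃[ M ] a N ≤ b M + ε

------------------------------------------------------------------------
-- Finite graphs

record FiniteGraph : Set₁ where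
  field
    V        : Set
    _≟_      : Binary.DecidableEquality V
    vertices : List V
    complete : ∀ v → v ∈ vertices
    unique   : Unique vertices
    Adj      : Rel V 0ℓ
    adj?     : Binary.Decidable Adj
    symmetric : Binary.Symmetric Adj

-- `edges` lists ordered pairs; an undirected edge {u , v} is represented by
-- both (u , v) and (v , u).
record Subgraph (V : Set) : Set where
  field
    vertices : List V
    edges    : List (V × V)

module _ (G : FiniteGraph) where
  open FiniteGraph G
  open DecMembership _≟_ using (_∈?_; _∉?_)
  open DecSubset _≟_ using (_⊆?_)
  open DecSubset (Product.≡-dec _≟_ _≟_) using () renaming (_⊆?_ to _⊆ᴱ?_)

  -- The nonempty list of the successive vertices visited.
  Path : Set
  Path = List V

  ∣_∣ : Path → ℕ
  ∣ β ∣ = pred (length β)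

  neighbours : V → List V
  neighbours v = filter (adj? v) vertices

  steps : Path → List (V × V)
  steps (u ∷ β@(v ∷ _)) = (u , v) ∷ steps β
  steps _               = []

  -- One vertex is appended to a loop-free path; the path is stored in reverse.
  visit : Path → V → Path
  visit γ w with w ∈? γ
  ... | yes _ = dropWhile (λ u → ¬? (u ≟ w)) γ
  ... | no  _ = w ∷ γ

  loopErasure : Path → Path
  loopErasure γ = reverse (foldl visit [] γ)

  -- Simple random walk from v stopped on hitting A, restricted to the event
  -- that this takes at most N steps: the trajectories not yet stopped after N
  -- steps are discarded along with their mass.
  walk : (N : ℕ) (A : List V) → V → Dist Path
  walk N A v with v ∈? A
  walk N       A v | yes _ = return [ v ]
  walk zero    A v | no  _ = []
  walk (suc N) A v | no  _ = uniform (neighbours v) >>= λ w → (v ∷_) <$> walk N A w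

  infix 4 _≐_ _≐?_
  _≐_ : Rel (Subgraph V) 0ℓ
  S ≐ T = (S.vertices ⊆ T.vertices × T.vertices ⊆ S.vertices)
        × (S.edges ⊆ T.edges × T.edges ⊆ S.edges)
    where
    module S = Subgraph S
    module T = Subgraph T

  _≐?_ : Binary.Decidable _≐_
  S ≐? T = ((S.vertices ⊆? T.vertices) ×-dec (T.vertices ⊆? S.vertices))
     ×-dec ((S.edges ⊆ᴱ? T.edges) ×-dec (T.edges ⊆ᴱ? S.edges))
    where
    module S = Subgraph S
    module T = Subgraph T

  IsOrdering : V → List V → Set
  IsOrdering r ord = r ∷ ord ↭ vertices

  module Wilson (r : V) (ord : List V) where

    -- The loop-erased increments added so far, in chronological order.
    History : Set
    History = List Path

    tree : History → Subgraph V
    tree βs = record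
      { vertices = r ∷ concat βs
      ; edges    = concatMap steps βs ++ map swap (concatMap steps βs)
      }

    next : History → Maybe V
    next βs = find (_∉? Subgraph.vertices (tree βs)) ord

    -- There is no outcome when the tree already contains every vertex.
    increment : (N : ℕ) → History → Dist Path
    increment N βs with next βs
    ... | nothing = []
    ... | just v  = loopErasure <$> walk N (Subgraph.vertices (tree βs)) v

    -- The history after k increments, and the same together with the
    -- (k+1)-st increment, on the event that every walk run takes at most N
    -- steps.  As N grows this event increases, so the probability of an event
    -- under the algorithm itself is the supremum over N of its probabilities
    -- under these laws.
    mutual
      history : (N k : ℕ) → Dist History
      history N zero    = return []
      history N (suc k) = (λ (βs , β) → βs ++ [ β ]) <$> historyAndNext N k

      historyAndNext : (N k : ℕ) → Dist (History × Path)
      historyAndNext N k = history N k >>= λ βs → (βs ,_) <$> increment N βs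

    -- P(|β| ≥ ℓ | F) ≤ q, where F is the tree after k increments and β is the
    -- (k+1)-st increment, in the form P(|β| ≥ ℓ , F) ≤ q P(F).
    NextLengthTail≤ : (k : ℕ) (F : Subgraph V) (ℓ : ℕ) (q : ℚ) → Set
    NextLengthTail≤ k F ℓ q =
      (λ N → Pr (λ (βs , β) → (tree βs ≐? F) ×-dec (ℓ ℕ.≤? ∣ β ∣)) (historyAndNext N k))
      ≤sup
      (λ N → q * Pr (λ βs → tree βs ≐? F) (history N k))

  module _ {m : ℕ} (Ring : Fin m → Pred V 0ℓ) where

    MeetsEveryRing : List V → Set
    MeetsEveryRing vs = ∀ k → ∃[ v ] v ∈ vs × Ring k v

    record IsTrunk (T : Subgraph V) (L : Path) : Set where
      field
        isPath   : Linked Adj L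
        isSimple : Unique L
        vertices⊆ : L ⊆ Subgraph.vertices T
        edges⊆    : steps L ⊆ Subgraph.edges T
        meets    : MeetsEveryRing L

------------------------------------------------------------------------
-- Cylindrical graphs

module _ (n m : ℕ) where

  CylVertex : Set
  CylVertex = Fin n × Fin m

  -- toℕ i′ ≡ toℕ i + 1 modulo n
  CyclicSuc : Rel (Fin n) 0ℓ
  CyclicSuc i i′ = (toℕ i′ ≡ suc (toℕ i)) ⊎ (suc (toℕ i) ≡ n × toℕ i′ ≡ 0)

  CylStep : Rel CylVertex 0ℓ
  CylStep (i , j) (i′ , j′) = (CyclicSuc i i′ × j ≡ j′) ⊎ (i ≡ i′ × toℕ j′ ≡ suc (toℕ j))

  CylAdj : Rel CylVertex 0ℓ
  CylAdj u v = CylStep u v ⊎ CylStep v u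

  cylStep? : Binary.Decidable CylStep
  cylStep? (i , j) (i′ , j′) =
    (((toℕ i′ ℕ.≟ suc (toℕ i)) ⊎-dec ((suc (toℕ i) ℕ.≟ n) ×-dec (toℕ i′ ℕ.≟ 0)))
      ×-dec (j Fin.≟ j′))
    ⊎-dec ((i Fin.≟ i′) ×-dec (toℕ j′ ℕ.≟ suc (toℕ j)))

  cylAdj? : Binary.Decidable CylAdj
  cylAdj? u v = cylStep? u v ⊎-dec cylStep? v u

  cylinder : FiniteGraph
  cylinder = record
    { V         = CylVertex
    ; _≟_       = Product.≡-dec Fin._≟_ Fin._≟_
    ; vertices  = cartesianProduct (allFin n) (allFin m)
    ; complete  = λ (i , j) → ∈-cartesianProduct⁺ (∈-allFin i) (∈-allFin j)
    ; unique    = Unique.cartesianProduct⁺ (Unique.allFin⁺ n) (Unique.allFin⁺ m)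
    ; Adj       = CylAdj
    ; adj?      = cylAdj?
    ; symmetric = ⊎-swap
    }

  CylRing : Fin m → Pred CylVertex 0ℓ
  CylRing k (_ , j) = j ≡ k

  InFirstRing InLastRing OnBoundary : Pred CylVertex 0ℓ
  InFirstRing (_ , j) = toℕ j ≡ 0
  InLastRing  (_ , j) = suc (toℕ j) ≡ m
  OnBoundary  v       = InFirstRing v ⊎ InLastRing v

  -- The sink is `nothing`.
  WiredVertex : Set
  WiredVertex = Maybe CylVertex

  WiredAdj : Rel WiredVertex 0ℓ
  WiredAdj nothing  nothing  = ⊥
  WiredAdj nothing  (just v) = OnBoundary v
  WiredAdj (just u) nothing  = OnBoundary u
  WiredAdj (just u) (just v) = CylAdj u v

  onBoundary? : Decidable OnBoundary
  onBoundary? (_ , j) = (toℕ j ℕ.≟ 0) ⊎-dec (suc (toℕ j) ℕ.≟ m)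

  wiredAdj? : Binary.Decidable WiredAdj
  wiredAdj? nothing  nothing  = no id
  wiredAdj? nothing  (just v) = onBoundary? v
  wiredAdj? (just u) nothing  = onBoundary? u
  wiredAdj? (just u) (just v) = cylAdj? u v

  wiredSymmetric : Binary.Symmetric WiredAdj
  wiredSymmetric {nothing} {nothing} = id
  wiredSymmetric {nothing} {just _}  = id
  wiredSymmetric {just _}  {nothing} = id
  wiredSymmetric {just _}  {just _}  = ⊎-swap

  wiredVertices : List WiredVertex
  wiredVertices = nothing ∷ map just (FiniteGraph.vertices cylinder)

  wiredComplete : ∀ v → v ∈ wiredVertices
  wiredComplete nothing  = here refl
  wiredComplete (just v) = there (∈-map⁺ just (FiniteGraph.complete cylinder v))

  wiredUnique : Unique wiredVertices
  wiredUnique =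
      ¬Any⇒All¬ _ (λ s∈ → case-⊥ (∈-map⁻ just s∈))
    ∷ Unique.map⁺ Maybe.just-injective (FiniteGraph.unique cylinder)
    where
    case-⊥ : ∀ {A : Set} {P : Pred CylVertex 0ℓ} →
             ∃[ v ] P v × nothing ≡ just v → A
    case-⊥ (_ , _ , ())

  wiredCylinder : FiniteGraph
  wiredCylinder = record
    { V         = WiredVertex
    ; _≟_       = Maybe.≡-dec (Product.≡-dec Fin._≟_ Fin._≟_)
    ; vertices  = wiredVertices
    ; complete  = wiredComplete
    ; unique    = wiredUnique
    ; Adj       = WiredAdj
    ; adj?      = wiredAdj?
    ; symmetric = λ {u} {v} → wiredSymmetric {u} {v}
    }

  WiredRing : Fin m → Pred WiredVertex 0ℓ
  WiredRing k = Maybe.Any (CylRing k)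

{-# OPTIONS --safe #-}

-- Part 1: visiting one vertex at a time, the loop erasure of a walk remains a
-- simple path from the start to the current vertex.  The first walk ends at
-- the root, and the ring index changes by at most one along an edge, so the
-- path from one boundary ring to the other takes every ring index in between.
--
-- Part 2: a loop erasure is no longer than the walk, so it suffices to bound
-- the hitting time of F.  As F meets every ring, each vertex has distance
-- t ≤ n from F, where n does not depend on m.  Degrees are at most D = n + 3,
-- so with x = 1/(2D) the potential φ(t) = 2 − xᵗ ∈ [1,2] contracts in one step
-- of the walk by a factor θ = 1 − xⁿ/2: some neighbour has potential at most
-- φ(t−1), the others at most 2.  Hence P(hitting time ≥ ℓ) ≤ φ(t) θˡ.

module Submission where

open import Defs
open import Data.Bool.Base using (true; false)
open import Data.Fin.Base using (Fin; toℕ; fromℕ<)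
import Data.Fin.Properties as Fin
open import Data.Integer.Base as ℤ using (+_)
import Data.Integer.Properties as ℤ
open import Data.List.Base
  using (List; []; _∷_; _++_; map; filter; length; [_]; foldl; reverse; reverseAcc;
         dropWhile; head; find; allFin)
open import Data.List.Properties using (length-map; length-reverse; length-tabulate)
import Data.List.Membership.DecPropositional as DecMembership
open import Data.List.Membership.Propositional using (_∈_; _∉_)
open import Data.List.Membership.Propositional.Properties
  using (∈-filter⁺; ∈-filter⁻; ∈-map⁺; ∈-map⁻; ∈-++⁺ˡ; ∈-++⁺ʳ; ∈-++⁻; ∈-∃++; ∈-allFin)
open import Data.List.Relation.Binary.Permutation.Propositional using (↭-sym; ↭⇒↭ₛ)
open import Data.List.Relation.Binary.Permutation.Propositional.Properties using (↭-reverse; shift; ↭-length)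
import Data.List.Relation.Binary.Permutation.Setoid.Properties as ↭ₛ
open import Data.List.Relation.Binary.Subset.Propositional using (_⊆_)
open import Data.List.Relation.Unary.All using (All; []; _∷_)
import Data.List.Relation.Unary.All as All
import Data.List.Relation.Unary.All.Properties as All
open import Data.List.Relation.Unary.AllPairs using ([]; _∷_)
open import Data.List.Relation.Unary.Any using (here; there)
import Data.List.Relation.Unary.Any.Properties as Any
open import Data.List.Relation.Unary.Linked using (Linked; []; [-]; _∷_)
open import Data.List.Relation.Unary.Unique.Propositional using (Unique)
import Data.List.Relation.Unary.Unique.Propositional.Properties as Unique
open import Data.Maybe.Base using (just; nothing)
import Data.Maybe.Base as Maybe
import Data.Maybe.Properties as Maybe
import Data.Maybe.Relation.Unary.Any as Maybe using (just)
open import Data.Nat.Base as ℕ using (ℕ; zero; suc; pred)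
import Data.Nat.Properties as ℕ
open import Data.Product.Base using (∃-syntax; _×_; _,_; proj₁; proj₂)
open import Data.Rational.Base
  using (ℚ; 0ℚ; 1ℚ; ½; *≤*; _/_; _+_; _*_; _-_; -_; _≤_; _<_; toℚᵘ; positive; nonNegative)
import Data.Rational.Properties as ℚ
open import Data.Rational.Solver using (module +-*-Solver)
import Data.Rational.Unnormalised.Base as ℚᵘ
import Data.Rational.Unnormalised.Properties as ℚᵘ
open import Data.Sum.Base using (_⊎_; inj₁; inj₂)
import Data.Sum.Base as Sum
open import Function.Base using (_∘_)
open import Level using (0ℓ)
open import Relation.Binary.Core using (Rel)
open import Relation.Binary.Definitions using (Symmetric)
open import Relation.Binary.PropositionalEquality hiding ([_])
open import Relation.Nullary using (¬_; yes; no; does; contradiction; ¬?)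
open import Relation.Nullary.Decidable using (_×-dec_)
open import Relation.Unary using (Pred; Decidable)

-- Natural numbers and unit fractions as rationals; order lemmas.

ι : ℕ → ℚ
ι k = + k / 1

ι-suc : ∀ k → ι (suc k) ≡ 1ℚ + ι k
ι-suc k = ℚ.toℚᵘ-injective (begin
  toℚᵘ (ι (suc k))            ≈⟨ ℚ.toℚᵘ-fromℚᵘ (ℚᵘ.mkℚᵘ (+ suc k) 0) ⟩
  ℚᵘ.mkℚᵘ (+ suc k) 0         ≈⟨ ℚᵘ.*≡* (cong (λ j → (+ 1 ℤ.+ j) ℤ.* + 1) (sym (ℤ.*-identityʳ (+ k)))) ⟩
  ℚᵘ.1ℚᵘ ℚᵘ.+ ℚᵘ.mkℚᵘ (+ k) 0 ≈⟨ ℚᵘ.+-congʳ ℚᵘ.1ℚᵘ (ℚᵘ.≃-sym (ℚ.toℚᵘ-fromℚᵘ (ℚᵘ.mkℚᵘ (+ k) 0))) ⟩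
  toℚᵘ 1ℚ ℚᵘ.+ toℚᵘ (ι k)     ≈⟨ ℚᵘ.≃-sym (ℚ.toℚᵘ-homo-+ 1ℚ (ι k)) ⟩
  toℚᵘ (1ℚ + ι k) ∎)
  where open import Relation.Binary.Reasoning.Setoid ℚᵘ.≃-setoid

ι-inverse : ∀ k → ι (suc k) * (+ 1 / suc k) ≡ 1ℚ
ι-inverse k = ℚ.toℚᵘ-injective (begin
  toℚᵘ (ι (suc k) * (+ 1 / suc k))            ≈⟨ ℚ.toℚᵘ-homo-* (ι (suc k)) (+ 1 / suc k) ⟩
  toℚᵘ (ι (suc k)) ℚᵘ.* toℚᵘ (+ 1 / suc k)
    ≈⟨ ℚᵘ.*-cong (ℚ.toℚᵘ-fromℚᵘ (ℚᵘ.mkℚᵘ (+ suc k) 0)) (ℚ.toℚᵘ-fromℚᵘ (ℚᵘ.mkℚᵘ (+ 1) k)) ⟩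
  ℚᵘ.mkℚᵘ (+ suc k) 0 ℚᵘ.* ℚᵘ.mkℚᵘ (+ 1) k
    ≈⟨ ℚᵘ.*≡* (trans (ℤ.*-identityʳ _)
             (trans (ℤ.*-comm (+ suc k) (+ 1)) (cong (+ 1 ℤ.*_) (sym (ℤ.*-identityˡ (+ suc k)))))) ⟩
  toℚᵘ 1ℚ ∎)
  where open import Relation.Binary.Reasoning.Setoid ℚᵘ.≃-setoid

unitFraction-positive : ∀ k → 0ℚ < + 1 / suc k
unitFraction-positive k = ℚ.positive⁻¹ (+ 1 / suc k) {{ℚ.normalize-pos 1 (suc k)}}

unitFraction-antitone : ∀ {j k} → j ℕ.≤ k → + 1 / suc k ≤ + 1 / suc j
unitFraction-antitone {j} {k} j≤k = ℚ.toℚᵘ-cancel-≤ (begin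
  toℚᵘ (+ 1 / suc k) ≃⟨ ℚ.toℚᵘ-fromℚᵘ (ℚᵘ.mkℚᵘ (+ 1) k) ⟩
  ℚᵘ.mkℚᵘ (+ 1) k    ≤⟨ ℚᵘ.*≤* (ℤ.*-monoˡ-≤-nonNeg (+ 1) (ℤ.+≤+ (ℕ.s≤s j≤k))) ⟩
  ℚᵘ.mkℚᵘ (+ 1) j    ≃⟨ ℚᵘ.≃-sym (ℚ.toℚᵘ-fromℚᵘ (ℚᵘ.mkℚᵘ (+ 1) j)) ⟩
  toℚᵘ (+ 1 / suc j) ∎)
  where open ℚᵘ.≤-Reasoning

*-monoˡ-≤ : ∀ {p q r} → 0ℚ ≤ r → p ≤ q → r * p ≤ r * q
*-monoˡ-≤ {r = r} 0≤r = ℚ.*-monoˡ-≤-nonNeg r {{nonNegative 0≤r}}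

*-monoʳ-≤ : ∀ {p q r} → 0ℚ ≤ r → p ≤ q → p * r ≤ q * r
*-monoʳ-≤ {r = r} 0≤r = ℚ.*-monoʳ-≤-nonNeg r {{nonNegative 0≤r}}

0≤*  : ∀ {p q} → 0ℚ ≤ p → 0ℚ ≤ q → 0ℚ ≤ p * q
0≤* {p} {q} 0≤p 0≤q = subst (_≤ p * q) (ℚ.*-zeroʳ p) (*-monoˡ-≤ 0≤p 0≤q)

0<* : ∀ {p q} → 0ℚ < p → 0ℚ < q → 0ℚ < p * q
0<* {p} {q} 0<p 0<q = ℚ.positive⁻¹ (p * q) {{ℚ.pos*pos⇒pos p {{positive 0<p}} q {{positive 0<q}}}}

p≤q⇒0≤q-p : ∀ {p q} → p ≤ q → 0ℚ ≤ q - p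
p≤q⇒0≤q-p {p} {q} p≤q = subst (_≤ q - p) (ℚ.+-inverseʳ p) (ℚ.+-monoˡ-≤ (- p) p≤q)

0≤q-p⇒p≤q : ∀ {p q} → 0ℚ ≤ q - p → p ≤ q
0≤q-p⇒p≤q {p} {q} 0≤q-p = begin
  p           ≡⟨ ℚ.+-identityˡ p ⟨
  0ℚ + p      ≤⟨ ℚ.+-monoˡ-≤ p 0≤q-p ⟩
  q - p + p   ≡⟨ ℚ.+-assoc q (- p) p ⟩
  q + (- p + p) ≡⟨ cong (λ r → q + r) (ℚ.+-inverseˡ p) ⟩
  q + 0ℚ      ≡⟨ ℚ.+-identityʳ q ⟩
  q           ∎
  where open ℚ.≤-Reasoning

-- Nonnegative weights and probabilities of events.

NonNegWeights : {A : Set} → Dist A → Set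
NonNegWeights = All (λ (p , _) → 0ℚ ≤ p)

module _ {A B : Set} where

  >>=-nonNeg : {d : Dist A} {f : A → Dist B} →
               NonNegWeights d → (∀ x → NonNegWeights (f x)) → NonNegWeights (d >>= f)
  >>=-nonNeg {[]}              []          _    = []
  >>=-nonNeg {(_ , x) ∷ _} (0≤p ∷ 0≤d) 0≤f =
    All.++⁺ (All.map⁺ (All.map (0≤* 0≤p) (0≤f x))) (>>=-nonNeg 0≤d 0≤f)

  <$>-nonNeg : {d : Dist A} {f : A → B} → NonNegWeights d → NonNegWeights (f <$> d)
  <$>-nonNeg 0≤d = All.map⁺ (All.map (λ 0≤p → 0≤p) 0≤d)

module _ {A : Set} where

  return-nonNeg : (x : A) → NonNegWeights (return x)
  return-nonNeg _ = ℚ.nonNegative⁻¹ 1ℚ ∷ []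

  uniform-nonNeg : (l : List A) → NonNegWeights (uniform l)
  uniform-nonNeg []       = []
  uniform-nonNeg (x ∷ xs) =
    All.map⁺ (All.universal (λ _ → ℚ.<⇒≤ (unitFraction-positive (length xs))) (x ∷ xs))

module _ {A : Set} {P : Pred A 0ℓ} (P? : Decidable P) where

  Pr-reject : ∀ {p x d} → ¬ P x → Pr P? ((p , x) ∷ d) ≡ Pr P? d
  Pr-reject {x = x} ¬px with P? x
  ... | yes px = contradiction px ¬px
  ... | no _   = refl

  Pr-none : (d : Dist A) → (∀ x → ¬ P x) → Pr P? d ≡ 0ℚ
  Pr-none []            _  = refl
  Pr-none ((_ , x) ∷ d) ¬P = trans (Pr-reject {d = d} (¬P x)) (Pr-none d ¬P)

  Pr-++ : (d e : Dist A) → Pr P? (d ++ e) ≡ Pr P? d + Pr P? e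
  Pr-++ []            e = sym (ℚ.+-identityˡ _)
  Pr-++ ((p , x) ∷ d) e with does (P? x)
  ... | true  = trans (cong (λ r → p + r) (Pr-++ d e)) (sym (ℚ.+-assoc p _ _))
  ... | false = Pr-++ d e

  Pr-scale : (p : ℚ) (d : Dist A) → Pr P? (map (λ (q , y) → p * q , y) d) ≡ p * Pr P? d
  Pr-scale p []            = sym (ℚ.*-zeroʳ p)
  Pr-scale p ((q , x) ∷ d) with does (P? x)
  ... | true  = trans (cong (λ r → p * q + r) (Pr-scale p d)) (sym (ℚ.*-distribˡ-+ p q _))
  ... | false = Pr-scale p d

  Pr-<$> : {B : Set} (f : B → A) (d : Dist B) → Pr P? (f <$> d) ≡ Pr (P? ∘ f) d
  Pr-<$> f []            = refl
  Pr-<$> f ((p , x) ∷ d) with does (P? (f x))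
  ... | true  = cong (λ r → p + r) (Pr-<$> f d)
  ... | false = Pr-<$> f d

  Pr->>=-∷ : {B : Set} (p : ℚ) (x : B) (d : Dist B) (f : B → Dist A) →
             Pr P? (((p , x) ∷ d) >>= f) ≡ p * Pr P? (f x) + Pr P? (d >>= f)
  Pr->>=-∷ p x d f =
    trans (Pr-++ (map _ (f x)) (d >>= f)) (cong (λ r → r + _) (Pr-scale p (f x)))

module _ {A : Set} {P Q : Pred A 0ℓ} (P? : Decidable P) (Q? : Decidable Q)
         (P⊆Q : ∀ x → P x → Q x) where

  Pr-mono : {d : Dist A} → NonNegWeights d → Pr P? d ≤ Pr Q? d
  Pr-mono {[]}          []          = ℚ.≤-refl
  Pr-mono {(p , x) ∷ d} (0≤p ∷ 0≤d) with P? x | Q? x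
  ... | yes px | no ¬qx = contradiction (P⊆Q x px) ¬qx
  ... | yes _  | yes _  = ℚ.+-monoʳ-≤ p (Pr-mono 0≤d)
  ... | no _   | no _   = Pr-mono 0≤d
  ... | no _   | yes _  = subst (_≤ p + Pr Q? d) (ℚ.+-identityˡ _) (ℚ.+-mono-≤ 0≤p (Pr-mono 0≤d))

module _ {A B : Set} {P : Pred A 0ℓ} (P? : Decidable P) {R : Pred B 0ℓ} (R? : Decidable R)
         {f : A → Dist B} {q : ℚ}
         (bound : ∀ x → P x → Pr R? (f x) ≤ q) (null : ∀ x → ¬ P x → Pr R? (f x) ≤ 0ℚ) where

  -- Total probability, in the form in which conditioning is stated: outcomes of `d` in `P`
  -- contribute at most `q` times their weight, the others nothing. There is no division by
  -- `Pr P? d`, so events of probability zero are covered too.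
  Pr->>=-conditional : {d : Dist A} → NonNegWeights d → Pr R? (d >>= f) ≤ q * Pr P? d
  Pr->>=-conditional {[]} [] = ℚ.≤-reflexive (sym (ℚ.*-zeroʳ q))
  Pr->>=-conditional {(p , x) ∷ d} (0≤p ∷ 0≤d) with P? x
  ... | yes px = begin
    Pr R? (((p , x) ∷ d) >>= f)          ≡⟨ Pr->>=-∷ R? p x d f ⟩
    p * Pr R? (f x) + Pr R? (d >>= f)
      ≤⟨ ℚ.+-mono-≤ (*-monoˡ-≤ 0≤p (bound x px)) (Pr->>=-conditional 0≤d) ⟩
    p * q + q * Pr P? d                  ≡⟨ cong (λ r → r + q * Pr P? d) (ℚ.*-comm p q) ⟩
    q * p + q * Pr P? d                  ≡⟨ ℚ.*-distribˡ-+ q p _ ⟨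
    q * (p + Pr P? d)                    ∎
    where open ℚ.≤-Reasoning
  ... | no ¬px = begin
    Pr R? (((p , x) ∷ d) >>= f)          ≡⟨ Pr->>=-∷ R? p x d f ⟩
    p * Pr R? (f x) + Pr R? (d >>= f)
      ≤⟨ ℚ.+-mono-≤ (*-monoˡ-≤ 0≤p (null x ¬px)) (Pr->>=-conditional 0≤d) ⟩
    p * 0ℚ + q * Pr P? d                 ≡⟨ cong (λ r → r + q * Pr P? d) (ℚ.*-zeroʳ p) ⟩
    0ℚ + q * Pr P? d                     ≡⟨ ℚ.+-identityˡ _ ⟩
    q * Pr P? d                          ∎
    where open ℚ.≤-Reasoning

module _ {A B : Set} {R : Pred B 0ℓ} (R? : Decidable R) {f : A → Dist B} {c : ℚ}
         (bound : ∀ x → Pr R? (f x) ≤ c) where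

  open +-*-Solver

  private
    weighted : ℚ → List A → Dist A
    weighted p = map (λ x → p , x)

  Pr-weighted : ∀ {p} → 0ℚ ≤ p → (l : List A) →
                Pr R? (weighted p l >>= f) ≤ ι (length l) * (p * c)
  Pr-weighted {p} 0≤p []       = ℚ.≤-reflexive (sym (ℚ.*-zeroˡ (p * c)))
  Pr-weighted {p} 0≤p (x ∷ xs) = begin
    Pr R? (weighted p (x ∷ xs) >>= f)                ≡⟨ Pr->>=-∷ R? p x (weighted p xs) f ⟩
    p * Pr R? (f x) + Pr R? (weighted p xs >>= f)
      ≤⟨ ℚ.+-mono-≤ (*-monoˡ-≤ 0≤p (bound x)) (Pr-weighted 0≤p xs) ⟩
    p * c + ι (length xs) * (p * c)
      ≡⟨ solve 2 (λ a k → a :+ k :* a := (con 1ℚ :+ k) :* a) refl (p * c) (ι (length xs)) ⟩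
    (1ℚ + ι (length xs)) * (p * c)                   ≡⟨ cong (_* (p * c)) (ι-suc (length xs)) ⟨
    ι (suc (length xs)) * (p * c)                    ∎
    where open ℚ.≤-Reasoning

  module _ {b : ℚ} {w : A} (better : Pr R? (f w) ≤ b) where

    -- Every term is at most `p * c`, and the term of `w` falls short of this by `p * (c - b)`. The
    -- saving is counted at the one occurrence of `w` that the membership proof gives; kept on the
    -- left, it passes through the induction as a summand.
    Pr-weighted-improved : ∀ {p} → 0ℚ ≤ p → (l : List A) → w ∈ l →
                           Pr R? (weighted p l >>= f) + p * (c - b) ≤ ι (length l) * (p * c)
    Pr-weighted-improved {p} 0≤p (x ∷ xs) (here refl) = begin
      Pr R? (weighted p (x ∷ xs) >>= f) + p * (c - b)
        ≡⟨ cong (_+ p * (c - b)) (Pr->>=-∷ R? p x (weighted p xs) f) ⟩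
      p * Pr R? (f x) + Pr R? (weighted p xs >>= f) + p * (c - b)
        ≤⟨ ℚ.+-monoˡ-≤ (p * (c - b)) (ℚ.+-mono-≤ (*-monoˡ-≤ 0≤p better) (Pr-weighted 0≤p xs)) ⟩
      p * b + ι (length xs) * (p * c) + p * (c - b)
        ≡⟨ solve 4 (λ p b c k → p :* b :+ k :* (p :* c) :+ p :* (c :- b) := (con 1ℚ :+ k) :* (p :* c))
             refl p b c (ι (length xs)) ⟩
      (1ℚ + ι (length xs)) * (p * c)
        ≡⟨ cong (_* (p * c)) (ι-suc (length xs)) ⟨
      ι (suc (length xs)) * (p * c)                                ∎
      where open ℚ.≤-Reasoning
    Pr-weighted-improved {p} 0≤p (x ∷ xs) (there w∈xs) = begin
      Pr R? (weighted p (x ∷ xs) >>= f) + p * (c - b)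
        ≡⟨ cong (_+ p * (c - b)) (Pr->>=-∷ R? p x (weighted p xs) f) ⟩
      p * Pr R? (f x) + Pr R? (weighted p xs >>= f) + p * (c - b)    ≡⟨ ℚ.+-assoc (p * Pr R? (f x)) _ _ ⟩
      p * Pr R? (f x) + (Pr R? (weighted p xs >>= f) + p * (c - b))
        ≤⟨ ℚ.+-mono-≤ (*-monoˡ-≤ 0≤p (bound x)) (Pr-weighted-improved 0≤p xs w∈xs) ⟩
      p * c + ι (length xs) * (p * c)
        ≡⟨ solve 2 (λ a k → a :+ k :* a := (con 1ℚ :+ k) :* a) refl (p * c) (ι (length xs)) ⟩
      (1ℚ + ι (length xs)) * (p * c)
        ≡⟨ cong (_* (p * c)) (ι-suc (length xs)) ⟨
      ι (suc (length xs)) * (p * c)                                  ∎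
      where open ℚ.≤-Reasoning

    -- The weights `1 / length l` sum to one, which turns the total into `c`. Each is at least
    -- `1 / suc k`, and since `b ≤ c`, replacing the weight of `w` by this smaller number only
    -- weakens the bound.
    Pr-uniform-improved : ∀ {k} → b ≤ c → (l : List A) → length l ℕ.≤ suc k → w ∈ l →
                          Pr R? (uniform l >>= f) ≤ c - (+ 1 / suc k) * (c - b)
    Pr-uniform-improved {k} b≤c l@(_ ∷ xs) (ℕ.s≤s len≤k) w∈l = begin
      Pr R? (uniform l >>= f)
        ≡⟨ solve 2 (λ X e → X := (X :+ e) :- e) refl (Pr R? (uniform l >>= f)) (p * (c - b)) ⟩
      (Pr R? (uniform l >>= f) + p * (c - b)) - p * (c - b)
                                                     ≤⟨ ℚ.+-monoˡ-≤ _ (Pr-weighted-improved 0≤p l w∈l) ⟩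
      ι (suc (length xs)) * (p * c) - p * (c - b)
        ≡⟨ cong (_- p * (c - b)) total-weight ⟩
      c - p * (c - b)
        ≤⟨ ℚ.+-monoʳ-≤ c (ℚ.neg-antimono-≤ (*-monoʳ-≤ 0≤c-b (unitFraction-antitone len≤k))) ⟩
      c - (+ 1 / suc k) * (c - b)                    ∎
      where
      open ℚ.≤-Reasoning
      p = + 1 / suc (length xs)
      0≤p : 0ℚ ≤ p
      0≤p = ℚ.<⇒≤ (unitFraction-positive (length xs))
      total-weight : ι (suc (length xs)) * (p * c) ≡ c
      total-weight = begin-equality
        ι (suc (length xs)) * (p * c)  ≡⟨ ℚ.*-assoc (ι (suc (length xs))) p c ⟨
        ι (suc (length xs)) * p * c    ≡⟨ cong (_* c) (ι-inverse (length xs)) ⟩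
        1ℚ * c                         ≡⟨ ℚ.*-identityˡ c ⟩
        c                              ∎
      0≤c-b : 0ℚ ≤ c - b
      0≤c-b = p≤q⇒0≤q-p b≤c

-- Powers, the potential and the decay rate.

^-positive : ∀ {p} → 0ℚ < p → ∀ n → 0ℚ < p ^ n
^-positive 0<p zero    = ℚ.positive⁻¹ 1ℚ
^-positive 0<p (suc n) = 0<* 0<p (^-positive 0<p n)

^-nonNeg : ∀ {p} → 0ℚ < p → ∀ n → 0ℚ ≤ p ^ n
^-nonNeg 0<p n = ℚ.<⇒≤ (^-positive 0<p n)

^-≤1 : ∀ {p} → 0ℚ < p → p ≤ 1ℚ → ∀ n → p ^ n ≤ 1ℚ
^-≤1         0<p p≤1 zero    = ℚ.≤-refl
^-≤1 {p} 0<p p≤1 (suc n) = begin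
  p * p ^ n ≤⟨ *-monoʳ-≤ (^-nonNeg 0<p n) p≤1 ⟩
  1ℚ * p ^ n ≡⟨ ℚ.*-identityˡ _ ⟩
  p ^ n     ≤⟨ ^-≤1 0<p p≤1 n ⟩
  1ℚ        ∎
  where open ℚ.≤-Reasoning

^-antitone : ∀ {p} → 0ℚ < p → p ≤ 1ℚ → ∀ {m n} → m ℕ.≤ n → p ^ n ≤ p ^ m
^-antitone 0<p p≤1 {n = n} ℕ.z≤n = ^-≤1 0<p p≤1 n
^-antitone 0<p p≤1 (ℕ.s≤s m≤n)   = *-monoˡ-≤ (ℚ.<⇒≤ 0<p) (^-antitone 0<p p≤1 m≤n)

2ℚ : ℚ
2ℚ = + 2 / 1

module DecayRate (k n : ℕ) where

  open +-*-Solver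

  -- Here `suc k` bounds the degrees and `n` the distances to the tree. The factor ½ in `x` gives
  -- `1 / suc k = 2x`, and the one in `h` gives `2h = xⁿ`.
  x h θ : ℚ
  x = ½ * (+ 1 / suc k)
  h = ½ * x ^ n
  θ = 1ℚ - h

  φ : ℕ → ℚ
  φ t = 2ℚ - x ^ t

  0<x : 0ℚ < x
  0<x = 0<* (ℚ.positive⁻¹ ½) (unitFraction-positive k)

  x≤1 : x ≤ 1ℚ
  x≤1 = ℚ.≤-trans
    (*-monoˡ-≤ {q = 1ℚ} (ℚ.nonNegative⁻¹ ½) (unitFraction-antitone {0} {k} ℕ.z≤n))
    (*≤* (ℤ.+≤+ (ℕ.s≤s ℕ.z≤n)))

  0<h : 0ℚ < h
  0<h = 0<* (ℚ.positive⁻¹ ½) (^-positive 0<x n)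

  h≤½ : h ≤ ½
  h≤½ = *-monoˡ-≤ {q = 1ℚ} (ℚ.nonNegative⁻¹ ½) (^-≤1 0<x x≤1 n)

  0<θ : 0ℚ < θ
  0<θ = ℚ.<-≤-trans (ℚ.positive⁻¹ (1ℚ - ½)) (ℚ.+-monoʳ-≤ 1ℚ (ℚ.neg-antimono-≤ h≤½))

  θ<1 : θ < 1ℚ
  θ<1 = ℚ.+-monoʳ-< 1ℚ (ℚ.neg-antimono-< 0<h)

  1≤φ : ∀ t → 1ℚ ≤ φ t
  1≤φ t = ℚ.+-monoʳ-≤ 2ℚ (ℚ.neg-antimono-≤ (^-≤1 0<x x≤1 t))

  0≤φ : ∀ t → 0ℚ ≤ φ t
  0≤φ t = ℚ.≤-trans (ℚ.nonNegative⁻¹ 1ℚ) (1≤φ t)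

  0≤φθ^ : ∀ t ℓ → 0ℚ ≤ φ t * θ ^ ℓ
  0≤φθ^ t ℓ = 0≤* (0≤φ t) (^-nonNeg 0<θ ℓ)

  φ≤2 : ∀ t → φ t ≤ 2ℚ
  φ≤2 t = ℚ.+-monoʳ-≤ 2ℚ (ℚ.neg-antimono-≤ (^-nonNeg 0<x t))

  -- Since `1 / suc k = 2x`, the left-hand side is `φ (suc t) - xᵗ⁺¹`, and the right-hand side is
  -- `φ (suc t) - h * φ (suc t)`. Now `h * φ (suc t) ≤ 2h = xⁿ ≤ xᵗ⁺¹`; the two summands of `gap`
  -- are the slack in these two inequalities.
  φ-contraction : ∀ {t} → t ℕ.< n → 2ℚ - (+ 1 / suc k) * (2ℚ - φ t) ≤ θ * φ (suc t)
  φ-contraction {t} t<n = 0≤q-p⇒p≤q (subst (0ℚ ≤_) (sym gap)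
    (ℚ.+-mono-≤ (p≤q⇒0≤q-p xⁿ≤xᵗ⁺¹) (0≤* (ℚ.<⇒≤ 0<h) (^-nonNeg 0<x (suc t)))))
    where
    xⁿ≤xᵗ⁺¹ : x ^ n ≤ x ^ suc t
    xⁿ≤xᵗ⁺¹ = ^-antitone 0<x x≤1 t<n
    gap : θ * φ (suc t) - (2ℚ - (+ 1 / suc k) * (2ℚ - φ t)) ≡ (x ^ suc t - x ^ n) + h * x ^ suc t
    gap = solve 3 (λ y z w →
      let x′ = con ½ :* y
          h′ = con ½ :* w
      in (con 1ℚ :- h′) :* (con 2ℚ :- x′ :* z) :- (con 2ℚ :- y :* (con 2ℚ :- (con 2ℚ :- z)))
         := (x′ :* z :- w) :+ h′ :* (x′ :* z))
      refl (+ 1 / suc k) (x ^ t) (x ^ n)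

-- Length of loop erasures and the tail of the hitting time.

module _ (G : FiniteGraph) where
  open FiniteGraph G
  open DecMembership _≟_ using (_∈?_)

  length-dropWhile : {P : Pred V 0ℓ} (P? : Decidable P) (γ : Path G) → length (dropWhile P? γ) ℕ.≤ length γ
  length-dropWhile P? []      = ℕ.z≤n
  length-dropWhile P? (u ∷ γ) with does (P? u)
  ... | true  = ℕ.m≤n⇒m≤1+n (length-dropWhile P? γ)
  ... | false = ℕ.≤-refl

  length-visit : ∀ γ w → length (visit G γ w) ℕ.≤ suc (length γ)
  length-visit γ w with w ∈? γ
  ... | yes _ = ℕ.m≤n⇒m≤1+n (length-dropWhile (λ u → ¬? (u ≟ w)) γ)
  ... | no _  = ℕ.≤-refl

  length-foldl-visit : ∀ γ δ → length (foldl (visit G) γ δ) ℕ.≤ length δ ℕ.+ length γ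
  length-foldl-visit γ []      = ℕ.≤-refl
  length-foldl-visit γ (w ∷ δ) = begin
    length (foldl (visit G) (visit G γ w) δ)  ≤⟨ length-foldl-visit (visit G γ w) δ ⟩
    length δ ℕ.+ length (visit G γ w)         ≤⟨ ℕ.+-monoʳ-≤ (length δ) (length-visit γ w) ⟩
    length δ ℕ.+ suc (length γ)               ≡⟨ ℕ.+-suc (length δ) (length γ) ⟩
    suc (length δ ℕ.+ length γ)               ∎
    where open ℕ.≤-Reasoning

  length-loopErasure : ∀ γ → ∣_∣ G (loopErasure G γ) ℕ.≤ ∣_∣ G γ
  length-loopErasure γ = ℕ.pred-mono-≤ (begin
    length (reverse (foldl (visit G) [] γ))  ≡⟨ length-reverse (foldl (visit G) [] γ) ⟩
    length (foldl (visit G) [] γ)            ≤⟨ length-foldl-visit [] γ ⟩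
    length γ ℕ.+ 0                           ≡⟨ ℕ.+-identityʳ _ ⟩
    length γ                                 ∎)
    where open ℕ.≤-Reasoning

  walk-nonNeg : ∀ N A v → NonNegWeights (walk G N A v)
  walk-nonNeg N A v with v ∈? A
  walk-nonNeg N       A v | yes _ = return-nonNeg (v ∷ [])
  walk-nonNeg zero    A v | no  _ = []
  walk-nonNeg (suc N) A v | no  _ =
    >>=-nonNeg (uniform-nonNeg (neighbours G v)) (λ w → <$>-nonNeg (walk-nonNeg N A w))

  module _ (r : V) (ord : List V) where
    open Wilson G r ord

    increment-nonNeg : ∀ N βs → NonNegWeights (increment N βs)
    increment-nonNeg N βs with next βs
    ... | nothing = []
    ... | just v  = <$>-nonNeg (walk-nonNeg N (Subgraph.vertices (tree βs)) v)

    mutual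
      history-nonNeg : ∀ N k → NonNegWeights (history N k)
      history-nonNeg N zero    = return-nonNeg []
      history-nonNeg N (suc k) = <$>-nonNeg (historyAndNext-nonNeg N k)

      historyAndNext-nonNeg : ∀ N k → NonNegWeights (historyAndNext N k)
      historyAndNext-nonNeg N k =
        >>=-nonNeg (history-nonNeg N k) (λ βs → <$>-nonNeg (increment-nonNeg N βs))

  -- The index only bounds the distance to `A` from above: as `inside` is available at every `t`, it
  -- says that `A` can be reached in at most `t` steps.
  data Near (A : List V) : ℕ → V → Set where
    inside : ∀ {t v} → v ∈ A → Near A t v
    step   : ∀ {t v w} → Adj v w → Near A t w → Near A (suc t) v

  module _ (k n : ℕ) where
    open DecayRate k n

    module _ (A : List V)
             (degree≤ : ∀ v → v ∉ A → length (neighbours G v) ℕ.≤ suc k)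
             (near : ∀ v → ∃[ t ] t ℕ.≤ n × Near A t v) where
      -- Induction on the budget `N`, for all `ℓ` and `t` at once: a step of the walk uses one unit
      -- of `N`, lowers by one the length still required, and multiplies the potential on average by
      -- at most `θ`. The bound does not mention `N`, so it survives the supremum over `N`.
      walk-tail : ∀ N ℓ {t v} → t ℕ.≤ n → Near A t v →
                  Pr (λ γ → ℓ ℕ.≤? ∣_∣ G γ) (walk G N A v) ≤ φ t * θ ^ ℓ
      walk-tail N ℓ {t} {v} t≤n v-near with v ∈? A
      walk-tail N zero {t} t≤n v-near | yes _ = begin
        1ℚ + 0ℚ          ≤⟨ 1≤φ t ⟩
        φ t              ≡⟨ ℚ.*-identityʳ (φ t) ⟨
        φ t * 1ℚ         ∎
        where open ℚ.≤-Reasoning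
      -- A walk stopped at once has length zero.
      walk-tail N (suc ℓ) {t} t≤n v-near | yes _ = 0≤φθ^ t (suc ℓ)
      -- Trajectories that exceed the budget carry no mass.
      walk-tail zero ℓ {t} t≤n v-near | no _ = 0≤φθ^ t ℓ
      walk-tail (suc N) ℓ t≤n (inside v∈A) | no v∉A = contradiction v∈A v∉A
      walk-tail (suc N) ℓ {suc t} {v} t<n (step {w = w} v~w w-near) | no v∉A = begin
        Pr long? (uniform (neighbours G v) >>= extend)
          -- Every neighbour obeys the crude bound `2ℚ * s`, by `near` and `φ ≤ 2`; the neighbour
          -- `w` on the way to `A` obeys `φ t * s`.
          ≤⟨ Pr-uniform-improved long? bound better φs≤2s (neighbours G v) (degree≤ v v∉A)
               (∈-filter⁺ (adj? v) (complete w) v~w) ⟩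
        2ℚ * s - (+ 1 / suc k) * (2ℚ * s - φ t * s)
          ≡⟨ solve 3 (λ y f s → con 2ℚ :* s :- y :* (con 2ℚ :* s :- f :* s) := (con 2ℚ :- y :* (con 2ℚ :- f)) :* s)
               refl (+ 1 / suc k) (φ t) s ⟩
        (2ℚ - (+ 1 / suc k) * (2ℚ - φ t)) * s
          ≤⟨ *-monoʳ-≤ 0≤s (φ-contraction t<n) ⟩
        θ * φ (suc t) * s
          ≡⟨ solve 3 (λ a b s → a :* b :* s := b :* (a :* s)) refl θ (φ (suc t)) s ⟩
        φ (suc t) * (θ * s)
          ≤⟨ *-monoˡ-≤ (0≤φ (suc t)) (^-suc-pred ℓ) ⟩
        φ (suc t) * θ ^ ℓ ∎
        where
        open ℚ.≤-Reasoning
        open +-*-Solver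
        long? : Decidable (λ γ → ℓ ℕ.≤ ∣_∣ G γ)
        long? γ = ℓ ℕ.≤? ∣_∣ G γ
        extend : V → Dist (Path G)
        extend w = (v ∷_) <$> walk G N A w
        -- The first step accounts for one unit of length. At `ℓ = 0` there is none to subtract, and
        -- `θ * s ≤ θ ^ ℓ` then rests on `θ < 1`.
        s = θ ^ pred ℓ
        0≤s : 0ℚ ≤ s
        0≤s = ^-nonNeg 0<θ (pred ℓ)
        φs≤2s : φ t * s ≤ 2ℚ * s
        φs≤2s = *-monoʳ-≤ 0≤s (φ≤2 t)
        ^-suc-pred : ∀ ℓ → θ * θ ^ pred ℓ ≤ θ ^ ℓ
        ^-suc-pred zero    = subst (_≤ 1ℚ) (sym (ℚ.*-identityʳ θ)) (ℚ.<⇒≤ θ<1)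
        ^-suc-pred (suc ℓ) = ℚ.≤-refl
        recurse : ∀ {t} w → t ℕ.≤ n → Near A t w → Pr long? (extend w) ≤ φ t * s
        recurse {t} w t≤n w-near = begin
          Pr long? (extend w) ≡⟨ Pr-<$> long? (v ∷_) (walk G N A w) ⟩
          Pr (long? ∘ (v ∷_)) (walk G N A w)
            -- As `∣ v ∷ γ ∣` is `length γ`, the event gives `pred ℓ ≤ pred (length γ) = ∣ γ ∣`.
            ≤⟨ Pr-mono (long? ∘ (v ∷_)) (λ γ → pred ℓ ℕ.≤? ∣_∣ G γ) (λ _ → ℕ.pred-mono-≤) (walk-nonNeg N A w) ⟩
          Pr (λ γ → pred ℓ ℕ.≤? ∣_∣ G γ) (walk G N A w) ≤⟨ walk-tail N (pred ℓ) t≤n w-near ⟩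
          φ t * s ∎
        bound : ∀ w → Pr long? (extend w) ≤ 2ℚ * s
        bound w with near w
        ... | t , t≤n , w-near = ℚ.≤-trans (recurse w t≤n w-near) (*-monoʳ-≤ 0≤s (φ≤2 t))
        better : Pr long? (extend w) ≤ φ t * s
        better = recurse w (ℕ.<⇒≤ t<n) w-near

    -- The hypothesis speaks of every history whose tree equals `F` as a set, because the walk is
    -- run against the vertex list of that tree and not against the list in `F`. The constant `2ℚ`
    -- bounds the potential of any starting vertex.
    nextLengthTail : ∀ r ord K F →
      (∀ βs → _≐_ G (Wilson.tree G r ord βs) F → let A = Subgraph.vertices (Wilson.tree G r ord βs) in
         (∀ v → v ∉ A → length (neighbours G v) ℕ.≤ suc k) × (∀ v → ∃[ t ] t ℕ.≤ n × Near A t v)) →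
      ∀ ℓ → Wilson.NextLengthTail≤ G r ord K F ℓ (2ℚ * θ ^ ℓ)
    -- The witness for `≤sup` is `N` itself: the inequality already holds at each budget, and `ε`
    -- only adds slack.
    nextLengthTail r ord K F regular ℓ N ε 0<ε = N , (begin
      Pr both? (historyAndNext N K)
        ≤⟨ Pr->>=-conditional tree≐F? both? given otherwise (history-nonNeg r ord N K) ⟩
      2ℚ * θ ^ ℓ * Pr tree≐F? (history N K)
        ≡⟨ ℚ.+-identityʳ (2ℚ * θ ^ ℓ * Pr tree≐F? (history N K)) ⟨
      2ℚ * θ ^ ℓ * Pr tree≐F? (history N K) + 0ℚ
        ≤⟨ ℚ.+-monoʳ-≤ (2ℚ * θ ^ ℓ * Pr tree≐F? (history N K)) (ℚ.<⇒≤ 0<ε) ⟩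
      2ℚ * θ ^ ℓ * Pr tree≐F? (history N K) + ε ∎)
      where
      open ℚ.≤-Reasoning
      open Wilson G r ord
      tree≐F? : Decidable (λ βs → _≐_ G (tree βs) F)
      tree≐F? βs = _≐?_ G (tree βs) F
      both? : Decidable (λ (p : History × Path G) → _≐_ G (tree (proj₁ p)) F × ℓ ℕ.≤ ∣_∣ G (proj₂ p))
      both? (βs , β) = tree≐F? βs ×-dec (ℓ ℕ.≤? ∣_∣ G β)
      long? : Decidable (λ γ → ℓ ℕ.≤ ∣_∣ G γ)
      long? γ = ℓ ℕ.≤? ∣_∣ G γ
      0≤q : 0ℚ ≤ 2ℚ * θ ^ ℓ
      0≤q = 0≤* (ℚ.nonNegative⁻¹ 2ℚ) (^-nonNeg 0<θ ℓ)
      increment-tail : ∀ βs → _≐_ G (tree βs) F → Pr long? (increment N βs) ≤ 2ℚ * θ ^ ℓ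
      increment-tail βs ≐F with next βs
      -- No starting vertex is left, so the law of the increment is empty.
      ... | nothing = 0≤q
      ... | just v with regular βs ≐F
      ...   | degree≤ , near with near v
      ...     | t , t≤n , v-near = begin
        Pr long? (loopErasure G <$> walk G N A v)
          ≡⟨ Pr-<$> long? (loopErasure G) (walk G N A v) ⟩
        Pr (long? ∘ loopErasure G) (walk G N A v)
          ≤⟨ Pr-mono (long? ∘ loopErasure G) long? (λ γ ℓ≤ → ℕ.≤-trans ℓ≤ (length-loopErasure γ))
               (walk-nonNeg N A v) ⟩
        Pr long? (walk G N A v)                           ≤⟨ walk-tail A degree≤ near N ℓ t≤n v-near ⟩
        φ t * θ ^ ℓ                                       ≤⟨ *-monoʳ-≤ (^-nonNeg 0<θ ℓ) (φ≤2 t) ⟩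
        2ℚ * θ ^ ℓ                                        ∎
        where A = Subgraph.vertices (tree βs)
      given : ∀ βs → _≐_ G (tree βs) F → Pr both? ((βs ,_) <$> increment N βs) ≤ 2ℚ * θ ^ ℓ
      given βs ≐F = begin
        Pr both? ((βs ,_) <$> increment N βs)   ≡⟨ Pr-<$> both? (βs ,_) (increment N βs) ⟩
        Pr (both? ∘ (βs ,_)) (increment N βs)
          ≤⟨ Pr-mono (both? ∘ (βs ,_)) long? (λ _ → proj₂) (increment-nonNeg r ord N βs) ⟩
        Pr long? (increment N βs)               ≤⟨ increment-tail βs ≐F ⟩
        2ℚ * θ ^ ℓ                              ∎
      otherwise : ∀ βs → ¬ _≐_ G (tree βs) F → Pr both? ((βs ,_) <$> increment N βs) ≤ 0ℚ
      otherwise βs ≭F = ℚ.≤-reflexive (trans (Pr-<$> both? (βs ,_) (increment N βs))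
        (Pr-none (both? ∘ (βs ,_)) (increment N βs) (λ _ → ≭F ∘ proj₁)))

-- Distinct lists, linked lists and intermediate values.

module _ {A : Set} where

  -- Pigeonhole: cutting one occurrence of `x` out of `ys` leaves a list that still contains `xs`,
  -- because `x` does not recur in `xs`.
  Unique-⊆⇒length≤ : {xs ys : List A} → Unique xs → xs ⊆ ys → length xs ℕ.≤ length ys
  Unique-⊆⇒length≤ {[]}     _          _     = ℕ.z≤n
  Unique-⊆⇒length≤ {x ∷ xs} (x∉xs ∷ xs!) xs⊆ys with ∈-∃++ (xs⊆ys (here refl))
  ... | as , bs , refl =
    subst (suc (length xs) ℕ.≤_) (sym (↭-length (shift x as bs))) (ℕ.s≤s (Unique-⊆⇒length≤ xs! xs⊆as++bs))
    where
    xs⊆as++bs : xs ⊆ as ++ bs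
    xs⊆as++bs z∈xs with ∈-++⁻ as (xs⊆ys (there z∈xs))
    ... | inj₁ z∈as            = ∈-++⁺ˡ z∈as
    ... | inj₂ (here refl)     = contradiction refl (All.lookup x∉xs z∈xs)
    ... | inj₂ (there z∈bs)    = ∈-++⁺ʳ as z∈bs

  reverse-Unique : {xs : List A} → Unique xs → Unique (reverse xs)
  reverse-Unique {xs} = ↭ₛ.Unique-resp-↭ (setoid A) (↭⇒↭ₛ (↭-sym (↭-reverse xs)))

  -- The two chains share the vertex `x`. Moving the next vertex onto the accumulator traverses an
  -- edge backwards, hence the symmetry.
  reverseAcc-Linked : {R : Rel A 0ℓ} → Symmetric R → ∀ {x acc xs} →
                      Linked R (x ∷ xs) → Linked R (x ∷ acc) → Linked R (reverseAcc (x ∷ acc) xs)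
  reverseAcc-Linked R-sym [-]         Racc = Racc
  reverseAcc-Linked R-sym (Rxy ∷ Rxs) Racc = reverseAcc-Linked R-sym Rxs (R-sym Rxy ∷ Racc)

  reverse-Linked : {R : Rel A 0ℓ} → Symmetric R → ∀ {xs} → Linked R xs → Linked R (reverse xs)
  reverse-Linked R-sym {[]}     _   = []
  reverse-Linked R-sym {x ∷ xs} Rxs = reverseAcc-Linked R-sym Rxs [-]

  find-accept : {P : Pred A 0ℓ} (P? : Decidable P) {x : A} {xs : List A} → P x → find P? (x ∷ xs) ≡ just x
  find-accept P? {x} px with P? x
  ... | yes _  = refl
  ... | no ¬px = contradiction px ¬px

  module _ {R : Rel A 0ℓ} (level : A → ℕ)
           (lipschitz : ∀ {u v} → R u v → level v ℕ.≤ suc (level u) × level u ℕ.≤ suc (level v)) where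

    -- Discrete intermediate value theorem: while `level u` differs from `k`, one edge cannot jump
    -- over `k`, so the next vertex is at `k` or still on the same side. Both orders of the end
    -- levels occur, as either boundary ring may carry the root.
    intermediate-level : ∀ {u v xs k} → Linked R (u ∷ xs) → v ∈ u ∷ xs →
                         (level u ℕ.≤ k × k ℕ.≤ level v) ⊎ (level v ℕ.≤ k × k ℕ.≤ level u) →
                         ∃[ w ] w ∈ u ∷ xs × level w ≡ k
    intermediate-level {u} {k = k} Rxs v∈ between with level u ℕ.≟ k
    ... | yes u≡k = u , here refl , u≡k
    intermediate-level Rxs (here refl) (inj₁ (u≤k , k≤u)) | no u≢k = contradiction (ℕ.≤-antisym u≤k k≤u) u≢k
    intermediate-level Rxs (here refl) (inj₂ (u≤k , k≤u)) | no u≢k = contradiction (ℕ.≤-antisym u≤k k≤u) u≢k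
    intermediate-level (Ruy ∷ Rxs) (there v∈) (inj₁ (u≤k , k≤v)) | no u≢k
      with intermediate-level Rxs v∈ (inj₁ (ℕ.≤-trans (proj₁ (lipschitz Ruy)) (ℕ.≤∧≢⇒< u≤k u≢k) , k≤v))
    ... | w , w∈ , w≡k = w , there w∈ , w≡k
    intermediate-level (Ruy ∷ Rxs) (there v∈) (inj₂ (v≤k , k≤u)) | no u≢k
      with intermediate-level Rxs v∈
             (inj₂ (v≤k , ℕ.≤-pred (ℕ.≤-trans (ℕ.≤∧≢⇒< k≤u (u≢k ∘ sym)) (proj₂ (lipschitz Ruy)))))
    ... | w , w∈ , w≡k = w , there w∈ , w≡k

-- Supports of composed laws.

module _ {A B : Set} where

  support-<$>⁻ : {f : A → B} (d : Dist A) {y : B} → y ∈ support (f <$> d) →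
                 ∃[ x ] x ∈ support d × y ≡ f x
  support-<$>⁻ ((_ , x) ∷ _) (here refl) = x , here refl , refl
  support-<$>⁻ (_ ∷ d)       (there y∈)  with support-<$>⁻ d y∈
  ... | x , x∈ , y≡fx = x , there x∈ , y≡fx

  support->>=⁻ : {f : A → Dist B} (d : Dist A) {y : B} → y ∈ support (d >>= f) →
                 ∃[ x ] x ∈ support d × y ∈ support (f x)
  support->>=⁻ {f} ((p , x) ∷ d) y∈ with ∈-map⁻ proj₂ y∈
  ... | (_ , y) , qy∈ , refl with ∈-++⁻ (map _ (f x)) qy∈
  ...   | inj₁ qy∈fx with ∈-map⁻ _ qy∈fx
  ...     | _ , ∈fx , refl = x , here refl , ∈-map⁺ proj₂ ∈fx
  support->>=⁻ ((p , x) ∷ d) y∈ | (_ , y) , qy∈ , refl | inj₂ qy∈d with support->>=⁻ d (∈-map⁺ proj₂ qy∈d)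
  ... | x′ , x′∈ , y∈fx′ = x′ , there x′∈ , y∈fx′

support-uniform⁻ : {A : Set} (l : List A) {x : A} → x ∈ support (uniform l) → x ∈ l
support-uniform⁻ l@(_ ∷ _) x∈ with ∈-map⁻ proj₂ x∈
... | _ , px∈ , refl with ∈-map⁻ _ px∈
...   | _ , x∈l , refl = x∈l

-- Loop erasures as simple paths; the first increment.

module _ (G : FiniteGraph) where
  open FiniteGraph G
  open DecMembership _≟_ using (_∈?_; _∉?_)

  -- Stored in reverse, as in `visit`.
  data SimplePath (u : V) : V → Path G → Set where
    start : SimplePath u u [ u ]
    step  : ∀ {v w γ} → SimplePath u v γ → Adj v w → w ∉ γ → SimplePath u w (w ∷ γ)

  SimplePath⇒Linked : ∀ {u v γ} → SimplePath u v γ → Linked Adj γ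
  SimplePath⇒Linked start                        = [-]
  SimplePath⇒Linked (step start v~w _)           = symmetric v~w ∷ [-]
  SimplePath⇒Linked (step γ@(step _ _ _) v~w _)  = symmetric v~w ∷ SimplePath⇒Linked γ

  SimplePath⇒Unique : ∀ {u v γ} → SimplePath u v γ → Unique γ
  SimplePath⇒Unique start          = [] ∷ []
  SimplePath⇒Unique (step γ _ w∉γ) = All.¬Any⇒All¬ _ w∉γ ∷ SimplePath⇒Unique γ

  source∈ : ∀ {u v γ} → SimplePath u v γ → u ∈ γ
  source∈ start        = here refl
  source∈ (step γ _ _) = there (source∈ γ)

  target-head : ∀ {u v γ} → SimplePath u v γ → ∃[ δ ] γ ≡ v ∷ δ
  target-head start        = [] , refl
  target-head (step _ _ _) = _ , refl

  -- The latest vertex is stored first, so the loop closed by the return to `w` is at the front of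
  -- the list. Deleting it leaves the path as it was when it reached `w`.
  dropWhile-SimplePath : ∀ {u v w γ} → SimplePath u v γ → w ∈ γ →
                         SimplePath u w (dropWhile (λ x → ¬? (x ≟ w)) γ)
  dropWhile-SimplePath {v = v} {w} γ w∈ with v ≟ w
  dropWhile-SimplePath {v = v} {w} start             w∈γ         | yes refl with v ≟ v
  ... | yes _  = start
  ... | no v≢v = contradiction refl v≢v
  dropWhile-SimplePath {v = v} {w} γ@(step _ _ _)    w∈γ         | yes refl with v ≟ v
  ... | yes _  = γ
  ... | no v≢v = contradiction refl v≢v
  dropWhile-SimplePath             start             (here refl) | no v≢w = contradiction refl v≢w
  dropWhile-SimplePath             (step _ _ _)      (here refl) | no v≢w = contradiction refl v≢w
  dropWhile-SimplePath {v = v} {w} (step γ _ _)      (there w∈γ) | no v≢w with v ≟ w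
  ... | yes v≡w = contradiction v≡w v≢w
  ... | no _    = dropWhile-SimplePath γ w∈γ

  visit-SimplePath : ∀ {u v w γ} → SimplePath u v γ → Adj v w → SimplePath u w (visit G γ w)
  visit-SimplePath {w = w} {γ} sp v~w with w ∈? γ
  ... | yes w∈γ = dropWhile-SimplePath sp w∈γ
  ... | no  w∉γ = step sp v~w w∉γ

  -- The walk visits v ∷ δ: the starting vertex v is not part of δ.
  data Trajectory (A : List V) : V → Path G → Set where
    stop : ∀ {v} → v ∈ A → Trajectory A v []
    move : ∀ {v w δ} → Adj v w → Trajectory A w δ → Trajectory A v (w ∷ δ)

  walk-trajectory : ∀ N A v {γ} → γ ∈ support (walk G N A v) → ∃[ δ ] γ ≡ v ∷ δ × Trajectory A v δ
  walk-trajectory N A v γ∈ with v ∈? A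
  walk-trajectory N       A v (here refl) | yes v∈A = [] , refl , stop v∈A
  walk-trajectory (suc N) A v γ∈          | no _ with support->>=⁻ (uniform (neighbours G v)) γ∈
  ... | w , w∈ , γ∈w with support-<$>⁻ (walk G N A w) γ∈w
  ...   | γ′ , γ′∈ , refl with walk-trajectory N A w γ′∈
  ...     | δ , refl , w-traj = w ∷ δ , refl , move v~w w-traj
    where
    v~w : Adj v w
    v~w = proj₂ (∈-filter⁻ (adj? v) {xs = vertices} (support-uniform⁻ (neighbours G v) w∈))

  foldl-visit-SimplePath : ∀ {A u v γ δ} → SimplePath u v γ → Trajectory A v δ →
                           ∃[ w ] w ∈ A × SimplePath u w (foldl (visit G) γ δ)
  foldl-visit-SimplePath sp (stop v∈A)        = _ , v∈A , sp
  foldl-visit-SimplePath sp (move v~w w-traj) = foldl-visit-SimplePath (visit-SimplePath sp v~w) w-traj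

  walk-loopErasure : ∀ N A v {β} → β ∈ support (loopErasure G <$> walk G N A v) →
                     ∃[ w ] ∃[ γ ] w ∈ A × SimplePath v w γ × β ≡ reverse γ
  walk-loopErasure N A v β∈ with support-<$>⁻ (walk G N A v) β∈
  ... | γ , γ∈ , refl with walk-trajectory N A v γ∈
  -- Visiting `v` from the empty path gives `[ v ]`, which is `start`; only `δ` remains to be folded
  -- in.
  ...   | δ , refl , v-traj with foldl-visit-SimplePath start v-traj
  ...     | w , w∈A , sp = w , _ , w∈A , sp , refl

  module _ (r v : V) (vs : List V) (v≢r : v ≢ r) where
    open Wilson G r (v ∷ vs)

    increment-next : ∀ N βs {w} → next βs ≡ just w →
                     increment N βs ≡ (loopErasure G <$> walk G N (Subgraph.vertices (tree βs)) w)
    increment-next N βs next≡ with next βs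
    increment-next N βs refl | just _ = refl

    next-[] : next [] ≡ just v
    next-[] = find-accept (_∉? Subgraph.vertices (tree [])) {xs = vs} λ where (here v≡r) → v≢r v≡r

    -- Before the first increment the tree is the single vertex `r`, so the walk from `v` ends
    -- exactly at `r`. Later increments are appended at the end of the history and leave its head
    -- unchanged.
    first-increment : ∀ N k {βs} → βs ∈ support (history N (suc k)) →
                      ∃[ γ ] SimplePath v r γ × head βs ≡ just (reverse γ)
    first-increment N k βs∈ with support-<$>⁻ (historyAndNext N k) βs∈
    ... | (βs , β) , ∈hn , refl with support->>=⁻ (history N k) ∈hn
    first-increment N zero _ | _ | _ , here refl , ∈inc with support-<$>⁻ (increment N []) ∈inc
    ... | β , β∈ , refl with walk-loopErasure N (r ∷ []) v
                           (subst (λ d → β ∈ support d) (increment-next N [] next-[]) β∈)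
    ...   | _ , γ , here refl , sp , refl = γ , sp , refl
    first-increment N (suc k) _ | _ | βs , βs∈ , ∈inc with support-<$>⁻ (increment N βs) ∈inc
    ... | β , _ , refl with βs | first-increment N k βs∈
    ...   | _ ∷ _ | γ , sp , head≡ = γ , sp , head≡

  steps⊆tree : ∀ r ord {βs β} → head βs ≡ just β → steps G β ⊆ Subgraph.edges (Wilson.tree G r ord βs)
  steps⊆tree r ord {_ ∷ _} refl e∈ = ∈-++⁺ˡ (∈-++⁺ˡ e∈)

  path⊆tree : ∀ r ord {βs β} → head βs ≡ just β → β ⊆ Subgraph.vertices (Wilson.tree G r ord βs)
  path⊆tree r ord {_ ∷ _} refl x∈ = there (∈-++⁺ˡ x∈)

-- Ring indices on the cylinder and the trunk.

module _ (n m : ℕ) where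

  level : CylVertex n m → ℕ
  level (_ , j) = toℕ j

  CylStep-level : ∀ {u v} → CylStep n m u v → level u ℕ.≤ level v × level v ℕ.≤ suc (level u)
  CylStep-level (inj₁ (_ , refl)) = ℕ.≤-refl , ℕ.n≤1+n _
  CylStep-level (inj₂ (_ , eq))   = subst (_ ℕ.≤_) (sym eq) (ℕ.n≤1+n _) , ℕ.≤-reflexive eq

  CylAdj-level : ∀ {u v} → CylAdj n m u v → level v ℕ.≤ suc (level u) × level u ℕ.≤ suc (level v)
  CylAdj-level (inj₁ st) with CylStep-level st
  ... | u≤v , v≤1+u = v≤1+u , ℕ.m≤n⇒m≤1+n u≤v
  CylAdj-level (inj₂ st) with CylStep-level st
  ... | v≤u , u≤1+v = ℕ.m≤n⇒m≤1+n v≤u , u≤1+v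

  OppositeBoundaries : Rel (CylVertex n m) 0ℓ
  OppositeBoundaries r v = (InFirstRing n m r × InLastRing n m v) ⊎ (InLastRing n m r × InFirstRing n m v)

  -- If `v` were `r`, its ring index would be both `0` and `m - 1`, forcing `m = 1`. Distinctness
  -- ensures that `v` is outside the initial tree and is the first starting vertex.
  opposite-boundaries-distinct : 2 ℕ.≤ m → ∀ {r v} → OppositeBoundaries r v → v ≢ r
  opposite-boundaries-distinct 2≤m {r} opposite refl =
    contradiction (ℕ.≤-trans 2≤m (m≤1 opposite)) λ { (ℕ.s≤s ()) }
    where
    m≤1 : OppositeBoundaries r r → m ℕ.≤ 1
    m≤1 (inj₁ (r₀ , rₘ)) = ℕ.≤-reflexive (trans (sym rₘ) (cong suc r₀))
    m≤1 (inj₂ (rₘ , r₀)) = ℕ.≤-reflexive (trans (sym rₘ) (cong suc r₀))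

  first-path-trunk : 2 ℕ.≤ m → (r v : CylVertex n m) (vs : List (CylVertex n m)) →
    OppositeBoundaries r v →
    let open Wilson (cylinder n m) r (v ∷ vs) in
    (N k : ℕ) (βs : History) → βs ∈ support (history N (suc k)) →
    ∃[ β ] head βs ≡ just β × IsTrunk (cylinder n m) (CylRing n m) (tree βs) β
  first-path-trunk 2≤m r v vs opposite N k βs βs∈
    with first-increment (cylinder n m) r v vs (opposite-boundaries-distinct 2≤m opposite) N k βs∈
  ... | γ , sp , head≡ = reverse γ , head≡ , record
    { isPath    = reverse-Linked Sum.swap (SimplePath⇒Linked (cylinder n m) sp)
    ; isSimple  = reverse-Unique (SimplePath⇒Unique (cylinder n m) sp)
    ; vertices⊆ = path⊆tree (cylinder n m) r (v ∷ vs) head≡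
    ; edges⊆    = steps⊆tree (cylinder n m) r (v ∷ vs) head≡
    ; meets     = meets
    }
    where
    ≤last : ∀ {a} (j : Fin m) → suc a ≡ m → toℕ j ℕ.≤ a
    ≤last j refl = ℕ.≤-pred (Fin.toℕ<n j)
    between : (j : Fin m) →
      OppositeBoundaries r v →
      (level r ℕ.≤ toℕ j × toℕ j ℕ.≤ level v) ⊎ (level v ℕ.≤ toℕ j × toℕ j ℕ.≤ level r)
    between j (inj₁ (r₀ , vₘ)) = inj₁ (subst (ℕ._≤ toℕ j) (sym r₀) ℕ.z≤n , ≤last j vₘ)
    between j (inj₂ (rₘ , v₀)) = inj₂ (subst (ℕ._≤ toℕ j) (sym v₀) ℕ.z≤n , ≤last j rₘ)
    meets : MeetsEveryRing (cylinder n m) (CylRing n m) (reverse γ)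
    -- As `γ` is stored in reverse, its head is the root `r` and the start `v` lies further along;
    -- hence `between` compares ring indices from `r` to `v`.
    meets j with target-head (cylinder n m) sp
    ... | δ , refl with intermediate-level level CylAdj-level (SimplePath⇒Linked (cylinder n m) sp)
                          (source∈ (cylinder n m) sp) (between j opposite)
    ...   | w , w∈ , level≡ = w , Any.reverse⁺ w∈ , Fin.toℕ-injective level≡

  -- Distances to the tree and degrees, uniformly in `m`.

  module _ (G : FiniteGraph) (embed : CylVertex n m → FiniteGraph.V G)
           (embed-adj : ∀ {u v} → CylAdj n m u v → FiniteGraph.Adj G (embed u) (embed v))
           {A : List (FiniteGraph.V G)} where

    -- The connecting path stays in one ring and moves monotonically from `i` to `i₀`, so `t` is
    -- their difference in ℕ and not the cyclic distance: cruder, but less than `n` and free of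
    -- arithmetic modulo `n`. Through `embed` the argument serves both graphs.
    ring-near : ∀ t i i₀ j → toℕ i₀ ≡ t ℕ.+ toℕ i ⊎ toℕ i ≡ t ℕ.+ toℕ i₀ →
                embed (i₀ , j) ∈ A → Near G A t (embed (i , j))
    ring-near zero i i₀ j eq i₀∈A with Fin.toℕ-injective {i = i} {i₀} (Sum.[ sym , (λ i≡i₀ → i≡i₀) ] eq)
    ... | refl = inside i₀∈A
    ring-near (suc t) i i₀ j (inj₁ eq) i₀∈A =
      step (embed-adj (inj₁ (inj₁ (inj₁ (Fin.toℕ-fromℕ< 1+i<n) , refl))))
           (ring-near t (fromℕ< 1+i<n) i₀ j (inj₁ (begin
             toℕ i₀                          ≡⟨ eq ⟩
             suc (t ℕ.+ toℕ i)               ≡⟨ ℕ.+-suc t (toℕ i) ⟨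
             t ℕ.+ suc (toℕ i)               ≡⟨ cong (t ℕ.+_) (Fin.toℕ-fromℕ< 1+i<n) ⟨
             t ℕ.+ toℕ (fromℕ< 1+i<n)        ∎)) i₀∈A)
      where
      open ≡-Reasoning
      1+i<n : suc (toℕ i) ℕ.< n
      1+i<n = ℕ.≤-<-trans (ℕ.≤-trans (ℕ.s≤s (ℕ.m≤n+m (toℕ i) t)) (ℕ.≤-reflexive (sym eq))) (Fin.toℕ<n i₀)
    ring-near (suc t) i i₀ j (inj₂ eq) i₀∈A =
      -- The ring edge is taken backwards: `i` is the successor of the vertex moved to, whose
      -- coordinate is `t + toℕ i₀`.
      step (embed-adj (inj₂ (inj₁ (inj₁ (trans eq (cong suc (sym (Fin.toℕ-fromℕ< i-1<n)))) , refl))))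
           (ring-near t (fromℕ< i-1<n) i₀ j (inj₂ (Fin.toℕ-fromℕ< i-1<n)) i₀∈A)
      where
      i-1<n : t ℕ.+ toℕ i₀ ℕ.< n
      i-1<n = ℕ.≤-trans (ℕ.≤-reflexive (sym eq)) (ℕ.<⇒≤ (Fin.toℕ<n i))

    ring-near-bounded : ∀ i i₀ j → embed (i₀ , j) ∈ A → ∃[ t ] t ℕ.≤ n × Near G A t (embed (i , j))
    ring-near-bounded i i₀ j i₀∈A with ℕ.≤-total (toℕ i) (toℕ i₀)
    ... | inj₁ i≤i₀ = toℕ i₀ ℕ.∸ toℕ i , ℕ.≤-trans (ℕ.m∸n≤m (toℕ i₀) (toℕ i)) (ℕ.<⇒≤ (Fin.toℕ<n i₀)) ,
                      ring-near _ i i₀ j (inj₁ (sym (ℕ.m∸n+n≡m i≤i₀))) i₀∈A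
    ... | inj₂ i₀≤i = toℕ i ℕ.∸ toℕ i₀ , ℕ.≤-trans (ℕ.m∸n≤m (toℕ i) (toℕ i₀)) (ℕ.<⇒≤ (Fin.toℕ<n i)) ,
                      ring-near _ i i₀ j (inj₂ (sym (ℕ.m∸n+n≡m i₀≤i))) i₀∈A

  -- The ring index is kept in ℕ, so that both vertical neighbours can be named
  -- even on the boundary.
  code : CylVertex n m → Fin n × ℕ
  code (i , j) = i , toℕ j

  code-injective : ∀ {u v} → code u ≡ code v → u ≡ v
  code-injective {i , _} eq with cong proj₁ eq | Fin.toℕ-injective (cong proj₂ eq)
  ... | refl | refl = refl

  -- All `n` vertices of the ring stand in for the two cyclic neighbours; the overcount is
  -- independent of `m`. A vertical code that names no neighbour only lengthens the list.
  neighbourCodes : CylVertex n m → List (Fin n × ℕ)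
  neighbourCodes (i , j) = (i , suc (toℕ j)) ∷ (i , pred (toℕ j)) ∷ map (_, toℕ j) (allFin n)

  length-neighbourCodes : ∀ v → length (neighbourCodes v) ≡ 2 ℕ.+ n
  length-neighbourCodes (i , j) =
    cong (2 ℕ.+_) (trans (length-map (_, toℕ j) (allFin n)) (length-tabulate {n = n} (λ i → i)))

  CylAdj⇒∈neighbourCodes : ∀ {u v} → CylAdj n m u v → code v ∈ neighbourCodes u
  CylAdj⇒∈neighbourCodes {u} {i , j} (inj₁ (inj₁ (_ , refl)))  = there (there (∈-map⁺ (_, toℕ j) (∈-allFin i)))
  CylAdj⇒∈neighbourCodes {u} {i , j} (inj₁ (inj₂ (refl , eq))) = here (cong (i ,_) eq)
  CylAdj⇒∈neighbourCodes {u} {i , j} (inj₂ (inj₁ (_ , refl)))  = there (there (∈-map⁺ (_, toℕ j) (∈-allFin i)))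
  CylAdj⇒∈neighbourCodes {u} {i , j} (inj₂ (inj₂ (refl , eq))) = there (here (cong (i ,_) (cong pred (sym eq))))

  module _ (G : FiniteGraph) where
    open FiniteGraph G

    -- The neighbours are filtered from a duplicate-free list, so their images under an injective
    -- `f` are distinct and the pigeonhole bound applies.
    degree≤ : {C : Set} (f : V → C) → (∀ {x y} → f x ≡ f y → x ≡ y) → {v : V} {cs : List C} →
              (∀ {w} → Adj v w → f w ∈ cs) → length (neighbours G v) ℕ.≤ length cs
    degree≤ f f-inj {v} {cs} adj∈ =
      subst (ℕ._≤ length cs) (length-map f (neighbours G v))
        (Unique-⊆⇒length≤ (Unique.map⁺ f-inj (Unique.filter⁺ (adj? v) unique)) codes⊆)
      where
      codes⊆ : map f (neighbours G v) ⊆ cs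
      codes⊆ c∈ with ∈-map⁻ f c∈
      ... | w , w∈ , refl = adj∈ (proj₂ (∈-filter⁻ (adj? v) {xs = vertices} w∈))

  -- One more than the number of codes, so that the cylinder shares its decay rate with the wired
  -- graph, where the sink can be a further neighbour.
  cylinder-degree≤ : ∀ v → length (neighbours (cylinder n m) v) ℕ.≤ 3 ℕ.+ n
  cylinder-degree≤ v = ℕ.≤-trans
    (degree≤ (cylinder n m) code code-injective {v} CylAdj⇒∈neighbourCodes)
    (ℕ.≤-trans (ℕ.≤-reflexive (length-neighbourCodes v)) (ℕ.n≤1+n (2 ℕ.+ n)))

  wired-degree≤ : ∀ v → length (neighbours (wiredCylinder n m) (just v)) ℕ.≤ 3 ℕ.+ n
  wired-degree≤ v = ℕ.≤-trans
    (degree≤ (wiredCylinder n m) (Maybe.map code) (Maybe.map-injective code-injective) {just v} (λ {w} → adj∈ {w}))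
    (ℕ.≤-reflexive (cong suc (trans (length-map just (neighbourCodes v)) (length-neighbourCodes v))))
    where
    adj∈ : ∀ {w} → WiredAdj n m (just v) w → Maybe.map code w ∈ nothing ∷ map just (neighbourCodes v)
    adj∈ {nothing} _   = here refl
    adj∈ {just _}  v~w = there (∈-map⁺ just (CylAdj⇒∈neighbourCodes v~w))

  -- Tail bounds for the two graphs.

  module _ (ℓ : ℕ) where
    -- The first argument is one less than the degree bound `3 + n`.
    open DecayRate (2 ℕ.+ n) n

    cylinder-tail : (r : CylVertex n m) (ord : List (CylVertex n m)) (k : ℕ) (F : Subgraph (CylVertex n m)) →
      MeetsEveryRing (cylinder n m) (CylRing n m) (Subgraph.vertices F) →
      Wilson.NextLengthTail≤ (cylinder n m) r ord k F ℓ (2ℚ * θ ^ ℓ)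
    cylinder-tail r ord k F meets =
      nextLengthTail (cylinder n m) (2 ℕ.+ n) n r ord k F
        (λ βs ≐F → (λ v _ → cylinder-degree≤ v) , near βs ≐F) ℓ
      where
      open Wilson (cylinder n m) r ord
      near : ∀ βs → _≐_ (cylinder n m) (tree βs) F →
             ∀ v → ∃[ t ] t ℕ.≤ n × Near (cylinder n m) (Subgraph.vertices (tree βs)) t v
      -- The ring to use is that of the vertex itself; `F⊆` carries the point of `F` found there
      -- into the tree.
      near βs ((_ , F⊆) , _) (i , j) with meets j
      ... | (i₀ , .j) , v∈F , refl = ring-near-bounded (cylinder n m) (λ v → v) (λ u~v → u~v) i i₀ j (F⊆ v∈F)

    wired-tail : (ord : List (WiredVertex n m)) (k : ℕ) (F : Subgraph (WiredVertex n m)) →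
      MeetsEveryRing (wiredCylinder n m) (WiredRing n m) (Subgraph.vertices F) →
      Wilson.NextLengthTail≤ (wiredCylinder n m) nothing ord k F ℓ (2ℚ * θ ^ ℓ)
    wired-tail ord k F meets =
      nextLengthTail (wiredCylinder n m) (2 ℕ.+ n) n nothing ord k F
        (λ βs ≐F → degree βs , near βs ≐F) ℓ
      where
      open Wilson (wiredCylinder n m) nothing ord
      -- The sink can have more than `3 + n` neighbours, but as the root it lies in every tree, and
      -- the walk never steps from it.
      degree : ∀ βs v → v ∉ Subgraph.vertices (tree βs) →
               length (neighbours (wiredCylinder n m) v) ℕ.≤ 3 ℕ.+ n
      degree βs nothing  s∉ = contradiction (here refl) s∉
      degree βs (just v) _  = wired-degree≤ v
      near : ∀ βs → _≐_ (wiredCylinder n m) (tree βs) F →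
             ∀ v → ∃[ t ] t ℕ.≤ n × Near (wiredCylinder n m) (Subgraph.vertices (tree βs)) t v
      near βs _ nothing = 0 , ℕ.z≤n , inside (here refl)
      near βs ((_ , F⊆) , _) (just (i , j)) with meets j
      ... | just (i₀ , .j) , v∈F , Maybe.just refl =
        ring-near-bounded (wiredCylinder n m) just (λ u~v → u~v) i i₀ j (F⊆ v∈F)

lemma2 : (n : ℕ) → 3 ℕ.≤ n →
    ((m : ℕ) → 2 ℕ.≤ m →
    (r v : CylVertex n m) (vs : List (CylVertex n m)) →
    IsOrdering (cylinder n m) r (v ∷ vs) →
    (InFirstRing n m r × InLastRing n m v) ⊎ (InLastRing n m r × InFirstRing n m v) →
    let open Wilson (cylinder n m) r (v ∷ vs) in
    (N k : ℕ) (βs : History) → βs ∈ support (history N (suc k)) →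
    ∃[ β ] head βs ≡ just β × IsTrunk (cylinder n m) (CylRing n m) (tree βs) β)
    ×
    (∃[ C ] ∃[ θ ] 0ℚ < C × 0ℚ < θ × θ < 1ℚ ×
    ((m : ℕ) → 2 ℕ.≤ m →
    ((r : CylVertex n m) (ord : List (CylVertex n m)) →
    IsOrdering (cylinder n m) r ord →
    (k : ℕ) (F : Subgraph (CylVertex n m)) →
    MeetsEveryRing (cylinder n m) (CylRing n m) (Subgraph.vertices F) →
    (ℓ : ℕ) →
    Wilson.NextLengthTail≤ (cylinder n m) r ord k F ℓ (C * θ ^ ℓ))
    ×
    ((ord : List (WiredVertex n m)) →
    IsOrdering (wiredCylinder n m) nothing ord →
    (k : ℕ) (F : Subgraph (WiredVertex n m)) →
    MeetsEveryRing (wiredCylinder n m) (WiredRing n m) (Subgraph.vertices F) →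
    (ℓ : ℕ) →
    Wilson.NextLengthTail≤ (wiredCylinder n m) nothing ord k F ℓ (C * θ ^ ℓ))))
lemma2 n _ =
    (λ m 2≤m r v vs _ → first-path-trunk n m 2≤m r v vs)
  , 2ℚ , θ , ℚ.positive⁻¹ 2ℚ , 0<θ , θ<1
  , λ m _ → (λ r ord _ k F meets ℓ → cylinder-tail n m ℓ r ord k F meets)
          , (λ ord _ k F meets ℓ → wired-tail n m ℓ ord k F meets)
  where open DecayRate (2 ℕ.+ n) n
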